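{- Let $G$ be a finite abstract simplicial complex with connection matrix $L$ and $g=L^{ -1}$. Then for all $x,y\in G$, $$g(x,y)=\omega(x)\,\omega(y)\,\chi\big(W^+(x)\cap W^+(y)\big).$$
   Context: A finite abstract simplicial complex $G$ is a finite set of non-empty finite sets closed under taking non-empty subsets; its elements are simplices. For $x\in G$, $\omega(x)=(-1)^{|x|-1}$. The connection matrix $L$ has $L(x,y)=1$ if $x\cap y\neq\emptyset$ and $0$ otherwise. The star of $x$ is $W^+(x)=\{y\in G: x\subseteq y\}$. For any subset $A\subseteq G$ (not necessarily a complex), $\chi(A)=\sum_{y\in A}\omega(y)$. -}

module Defs where

open import Algebra.Bundles using (Monoid)
import Algebra.Definitions.RawMonoid as RawMonoidDefs
open import Data.Bool using (if_then_else_)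
open import Data.Fin using (Fin; _≟_)
open import Data.Fin.Subset using (Subset; Nonempty; _⊆_; _∩_; ∣_∣)
open import Data.Fin.Subset.Properties using (_⊆?_; nonempty?)
open import Data.Integer as ℤ using (ℤ; 0ℤ; 1ℤ; -1ℤ)
import Data.Integer.Properties as ℤ
open import Data.Nat using (ℕ; _∸_)
open import Data.Product using (∃; _×_)
open import Data.Rational as ℚ using (ℚ; 0ℚ; 1ℚ)
import Data.Rational.Properties as ℚ
open import Data.Vec using (lookup; tabulate)
open import Function.Definitions using (Injective)
open import Relation.Binary.PropositionalEquality using (_≡_)
open import Relation.Nullary using (does)

open RawMonoidDefs (Monoid.rawMonoid ℤ.+-0-monoid) public using () renaming (sum to sumℤ)
open RawMonoidDefs (Monoid.rawMonoid ℚ.+-0-monoid) public using () renaming (sum to sumℚ)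

-- The vertices are labelled by Fin n; a label need not occur in any simplex.
-- The finite set of simplices is given by an enumeration without repetition,
-- so that Fin size serves as the index set of matrices over the complex.
record SimplicialComplex (n : ℕ) : Set where
  field
    size      : ℕ
    vertices  : Fin size → Subset n
    injective : Injective _≡_ _≡_ vertices
    nonempty  : ∀ x → Nonempty (vertices x)
    closed    : ∀ x (s : Subset n) → Nonempty s → s ⊆ vertices x → ∃ λ y → vertices y ≡ s

  Simplex : Set
  Simplex = Fin size

  ω : Simplex → ℤ
  ω x = -1ℤ ℤ.^ (∣ vertices x ∣ ∸ 1)

  -- A Subset size is an arbitrary set of simplices, not necessarily a complex.
  χ : Subset size → ℤ
  χ A = sumℤ λ y → if lookup A y then ω y else 0ℤ

  W⁺ : Simplex → Subset size
  W⁺ x = tabulate λ y → does (vertices x ⊆? vertices y)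

  L : Simplex → Simplex → ℤ
  L x y = if does (nonempty? (vertices x ∩ vertices y)) then 1ℤ else 0ℤ

fromℤ : ℤ → ℚ
fromℤ z = z ℚ./ 1

Matrix : ℕ → Set
Matrix m = Fin m → Fin m → ℚ

identity : ∀ {m} → Matrix m
identity i j = if does (i ≟ j) then 1ℚ else 0ℚ

_⊗_ : ∀ {m} → Matrix m → Matrix m → Matrix m
(A ⊗ B) i k = sumℚ λ j → A i j ℚ.* B j k

IsInverse : ∀ {m} → Matrix m → Matrix m → Set
IsInverse A B = (∀ i j → (A ⊗ B) i j ≡ identity i j) × (∀ i j → (B ⊗ A) i j ≡ identity i j)

connectionMatrix : ∀ {n} (G : SimplicialComplex n) → Matrix (SimplicialComplex.size G)
connectionMatrix G x y = fromℤ (SimplicialComplex.L G x y)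

{-# OPTIONS --safe #-}

-- Let N be the inclusion matrix of the complex and D the diagonal matrix of ω.
-- A nonempty simplex has Euler characteristic 1, so L = Nᵀ D N, and the
-- alternating sum of ω over an interval of faces vanishes unless the interval
-- is a point, so N D N = D, that is (D N)² = 1.
-- Hence L⁻¹ = D N D Nᵀ D, and its entries are the claimed ones.

module Submission where

open import Algebra.Bundles using (CommutativeRing; CommutativeSemiring)
import Algebra.Properties.Semiring.Sum as SemiringSum
open import Data.Bool using (Bool; true; false; if_then_else_; _∧_)
import Data.Bool as Bool
open import Data.Fin using (Fin; zero; suc; _≟_)
open import Data.Fin.Subset using (Subset; Nonempty; inside; outside; _⊆_; _∩_; ∣_∣; ⊥)
open import Data.Fin.Subset.Properties using (_⊆?_; nonempty?; Empty-unique; ∉⊥; ⊥⊆; ∣⊥∣≡0; ∩-comm; p∩q⊆p; p∩q⊆q; x∈p∩q⁺)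
open import Data.Integer using (ℤ; 0ℤ; 1ℤ; -1ℤ; _+_; _-_; _*_; -_; _^_)
import Data.Integer.Properties as ℤ
open import Data.Integer.Tactic.RingSolver using (solve-∀)
open import Data.Nat using (ℕ; zero; suc; _∸_)
open import Data.Product using (∃; _×_; _,_)
import Data.Rational as ℚ
import Data.Rational.Properties as ℚ
import Data.Rational.Unnormalised as ℚᵘ
import Data.Rational.Unnormalised.Properties as ℚᵘ
open import Data.Sum using (_⊎_; inj₁; inj₂)
open import Data.Vec using ([]; _∷_; there; lookup)
open import Data.Vec.Properties using (≡-dec; lookup-zipWith; lookup∘tabulate)
open import Function using (_∘_; mk⇔)
open import Level using (Level)
open import Relation.Binary.Definitions using (DecidableEquality)
open import Relation.Binary.PropositionalEquality using (_≡_; refl; sym; trans; cong; cong₂; module ≡-Reasoning)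
open import Relation.Nullary using (¬_; yes; no; does)
open import Relation.Nullary.Decidable using (dec-true; dec-false; does-⇔; _×-dec_)
open import Defs

-- Matrix algebra over a commutative semiring, used for both ℤ and ℚ.

module MatrixAlgebra {c ℓ : Level} (R : CommutativeSemiring c ℓ) where

  open CommutativeSemiring R using (Carrier; _≈_; 0#; 1#; setoid; semiring; zeroˡ; +-cong; +-identityˡ; +-identityʳ; *-comm; *-cong; *-congʳ; *-assoc; *-identityˡ)
    renaming (_+_ to _⊞_; _*_ to _⊠_; refl to ≈-refl; trans to ≈-trans; reflexive to ≈-reflexive)
  open SemiringSum semiring using (sum; sum-cong-≋; sum-replicate-zero; ∑-comm; *-distribˡ-sum; *-distribʳ-sum)
  open import Relation.Binary.Reasoning.Setoid setoid

  infixl 7 _·_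
  infix 4 _≋_

  Mat : ℕ → Set c
  Mat m = Fin m → Fin m → Carrier

  _≋_ : ∀ {m} → Mat m → Mat m → Set ℓ
  A ≋ B = ∀ i j → A i j ≈ B i j

  _·_ : ∀ {m} → Mat m → Mat m → Mat m
  (A · B) i k = sum λ j → A i j ⊠ B j k

  ⟦_⟧ : Bool → Carrier
  ⟦ b ⟧ = if b then 1# else 0#

  𝟙 : ∀ {m} → Mat m
  𝟙 i j = ⟦ does (i ≟ j) ⟧

  𝟙-sym : ∀ {m} (i j : Fin m) → 𝟙 i j ≡ 𝟙 j i
  𝟙-sym i j = cong ⟦_⟧ (does-⇔ (mk⇔ sym sym) (i ≟ j) (j ≟ i))

  sum-zero : ∀ {m} {f : Fin m → Carrier} → (∀ i → f i ≈ 0#) → sum f ≈ 0#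
  sum-zero {m} f≈0 = ≈-trans (sum-cong-≋ f≈0) (sum-replicate-zero m)

  sum-𝟙 : ∀ {m} (i : Fin m) (f : Fin m → Carrier) → sum (λ j → 𝟙 i j ⊠ f j) ≈ f i
  sum-𝟙 zero    f = ≈-trans (+-cong (*-identityˡ _) (sum-zero (zeroˡ ∘ f ∘ suc))) (+-identityʳ _)
  sum-𝟙 (suc i) f = ≈-trans (+-cong (zeroˡ _) (sum-𝟙 i (f ∘ suc))) (+-identityˡ _)

  ·-cong : ∀ {m} {A A′ B B′ : Mat m} → A ≋ A′ → B ≋ B′ → A · B ≋ A′ · B′
  ·-cong A≋A′ B≋B′ i k = sum-cong-≋ λ j → *-cong (A≋A′ i j) (B≋B′ j k)

  ·-congˡ : ∀ {m} (A : Mat m) {B B′ : Mat m} → B ≋ B′ → A · B ≋ A · B′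
  ·-congˡ A = ·-cong {A = A} λ _ _ → ≈-refl

  ·-congʳ : ∀ {m} (B : Mat m) {A A′ : Mat m} → A ≋ A′ → A · B ≋ A′ · B
  ·-congʳ B A≋A′ = ·-cong {B = B} A≋A′ λ _ _ → ≈-refl

  ·-assoc : ∀ {m} (A B C : Mat m) → (A · B) · C ≋ A · (B · C)
  ·-assoc A B C i l = begin
    sum (λ k → sum (λ j → A i j ⊠ B j k) ⊠ C k l)    ≈⟨ sum-cong-≋ (λ k → *-distribʳ-sum (C k l) (λ j → A i j ⊠ B j k)) ⟩
    sum (λ k → sum (λ j → A i j ⊠ B j k ⊠ C k l))    ≈⟨ ∑-comm (λ k j → A i j ⊠ B j k ⊠ C k l) ⟩
    sum (λ j → sum (λ k → A i j ⊠ B j k ⊠ C k l))    ≈⟨ sum-cong-≋ (λ j → sum-cong-≋ λ k → *-assoc (A i j) (B j k) (C k l)) ⟩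
    sum (λ j → sum (λ k → A i j ⊠ (B j k ⊠ C k l)))  ≈⟨ sum-cong-≋ (λ j → *-distribˡ-sum (A i j) (λ k → B j k ⊠ C k l)) ⟨
    sum (λ j → A i j ⊠ sum (λ k → B j k ⊠ C k l))    ∎

  ·-identityˡ : ∀ {m} (A : Mat m) → 𝟙 · A ≋ A
  ·-identityˡ A i k = sum-𝟙 i (λ j → A j k)

  ·-identityʳ : ∀ {m} (A : Mat m) → A · 𝟙 ≋ A
  ·-identityʳ A i k = begin
    sum (λ j → A i j ⊠ 𝟙 j k)  ≈⟨ sum-cong-≋ (λ j → *-comm (A i j) (𝟙 j k)) ⟩
    sum (λ j → 𝟙 j k ⊠ A i j)  ≈⟨ sum-cong-≋ (λ j → *-congʳ (≈-reflexive (𝟙-sym j k))) ⟩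
    sum (λ j → 𝟙 k j ⊠ A i j)  ≈⟨ sum-𝟙 k (A i) ⟩
    A i k                      ∎

  -- The usual uniqueness argument `B = B(AC) = (BA)C = C`. It identifies an arbitrary inverse with
  -- the explicit one.
  left-inverse≋right-inverse : ∀ {m} (A B C : Mat m) → B · A ≋ 𝟙 → A · C ≋ 𝟙 → B ≋ C
  left-inverse≋right-inverse A B C BA AC i j = begin
    B i j              ≈⟨ ·-identityʳ B i j ⟨
    (B · 𝟙) i j        ≈⟨ ·-congˡ B AC i j ⟨
    (B · (A · C)) i j  ≈⟨ ·-assoc B A C i j ⟨
    ((B · A) · C) i j  ≈⟨ ·-congʳ C BA i j ⟩
    (𝟙 · C) i j        ≈⟨ ·-identityˡ C i j ⟩
    C i j              ∎

  -- The inner pair `B`, `C` cancels first, which brings `A` and `E` together.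
  telescope : ∀ {m} (A B C E : Mat m) → B · C ≋ 𝟙 → A · E ≋ 𝟙 → (A · B) · (C · E) ≋ 𝟙
  telescope A B C E BC AE i j = begin
    ((A · B) · (C · E)) i j  ≈⟨ ·-assoc A B (C · E) i j ⟩
    (A · (B · (C · E))) i j  ≈⟨ ·-congˡ A (·-assoc B C E) i j ⟨
    (A · ((B · C) · E)) i j  ≈⟨ ·-congˡ A (·-congʳ E BC) i j ⟩
    (A · (𝟙 · E)) i j        ≈⟨ ·-congˡ A (·-identityˡ E) i j ⟩
    (A · E) i j              ≈⟨ AE i j ⟩
    𝟙 i j                    ∎

  -- Transposing `A · B ≋ 𝟙` reverses the factors, and symmetric factors are unchanged by it. This
  -- yields the left inverse from the right one without a second computation.
  symmetric-commute : ∀ {m} (A B : Mat m) → (∀ i j → A i j ≈ A j i) → (∀ i j → B i j ≈ B j i) →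
                      A · B ≋ 𝟙 → B · A ≋ 𝟙
  symmetric-commute A B symA symB AB i j = begin
    sum (λ k → B i k ⊠ A k j)  ≈⟨ sum-cong-≋ (λ k → ≈-trans (*-comm _ _) (*-cong (symA k j) (symB i k))) ⟩
    sum (λ k → A j k ⊠ B k i)  ≈⟨ AB j i ⟩
    𝟙 j i                      ≈⟨ ≈-reflexive (𝟙-sym j i) ⟩
    𝟙 i j                      ∎

module ℤMat = MatrixAlgebra (CommutativeRing.commutativeSemiring ℤ.+-*-commutativeRing)
module ℚMat = MatrixAlgebra (CommutativeRing.commutativeSemiring ℚ.+-*-commutativeRing)

open ℤMat using (⟦_⟧; 𝟙; _·_; sum-𝟙)
open SemiringSum (CommutativeRing.semiring ℤ.+-*-commutativeRing) using (sum-cong-≗; ∑-distrib-+; *-distribˡ-sum)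

⟦⟧-∧ : ∀ a b → ⟦ a ∧ b ⟧ ≡ ⟦ a ⟧ * ⟦ b ⟧
⟦⟧-∧ true  b = sym (ℤ.*-identityˡ ⟦ b ⟧)
⟦⟧-∧ false b = refl

-- Sums over the Boolean cube

_≟ˢ_ : ∀ {n} → DecidableEquality (Subset n)
_≟ˢ_ = ≡-dec Bool._≟_

-- Branching on the first vertex pairs each subset avoiding it with the one obtained by adjoining
-- it; the alternating sums below cancel along this pairing.
∑⊆ : ∀ {n} → (Subset n → ℤ) → ℤ
∑⊆ {zero}  f = f []
∑⊆ {suc n} f = ∑⊆ (f ∘ (outside ∷_)) + ∑⊆ (f ∘ (inside ∷_))

∑⊆-cong : ∀ {n} {f g : Subset n → ℤ} → (∀ s → f s ≡ g s) → ∑⊆ f ≡ ∑⊆ g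
∑⊆-cong {zero}  f≗g = f≗g []
∑⊆-cong {suc n} f≗g = cong₂ _+_ (∑⊆-cong (f≗g ∘ (outside ∷_))) (∑⊆-cong (f≗g ∘ (inside ∷_)))

∑⊆-*ˡ : ∀ {n} c (f : Subset n → ℤ) → ∑⊆ (λ s → c * f s) ≡ c * ∑⊆ f
∑⊆-*ˡ {zero}  c f = refl
∑⊆-*ˡ {suc n} c f = trans (cong₂ _+_ (∑⊆-*ˡ c (f ∘ (outside ∷_))) (∑⊆-*ˡ c (f ∘ (inside ∷_))))
                        (sym (ℤ.*-distribˡ-+ c (∑⊆ (f ∘ (outside ∷_))) (∑⊆ (f ∘ (inside ∷_)))))

∑⊆-+ : ∀ {n} (f g : Subset n → ℤ) → ∑⊆ (λ s → f s + g s) ≡ ∑⊆ f + ∑⊆ g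
∑⊆-+ {zero}  f g = refl
∑⊆-+ {suc n} f g = trans
  (cong₂ _+_ (∑⊆-+ (f ∘ (outside ∷_)) (g ∘ (outside ∷_))) (∑⊆-+ (f ∘ (inside ∷_)) (g ∘ (inside ∷_))))
  (interchange (∑⊆ (f ∘ (outside ∷_))) (∑⊆ (g ∘ (outside ∷_))) (∑⊆ (f ∘ (inside ∷_))) (∑⊆ (g ∘ (inside ∷_))))
  where
  interchange : ∀ a b c d → (a + b) + (c + d) ≡ (a + c) + (b + d)
  interchange = solve-∀

∑⊆-zero : ∀ {n} {f : Subset n → ℤ} → (∀ s → f s ≡ 0ℤ) → ∑⊆ f ≡ 0ℤ
∑⊆-zero {zero}  f≗0 = f≗0 []
∑⊆-zero {suc n} f≗0 = cong₂ _+_ (∑⊆-zero (f≗0 ∘ (outside ∷_))) (∑⊆-zero (f≗0 ∘ (inside ∷_)))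

sum-∑⊆-comm : ∀ {m n} (f : Fin m → Subset n → ℤ) →
              sumℤ (λ i → ∑⊆ (f i)) ≡ ∑⊆ (λ s → sumℤ (λ i → f i s))
sum-∑⊆-comm {n = zero}  f = refl
sum-∑⊆-comm {n = suc n} f = trans
  (∑-distrib-+ (λ i → ∑⊆ (f i ∘ (outside ∷_))) (λ i → ∑⊆ (f i ∘ (inside ∷_))))
  (cong₂ _+_ (sum-∑⊆-comm (λ i → f i ∘ (outside ∷_))) (sum-∑⊆-comm (λ i → f i ∘ (inside ∷_))))

∑⊆-δ : ∀ {n} (t : Subset n) (f : Subset n → ℤ) → ∑⊆ (λ s → ⟦ does (t ≟ˢ s) ⟧ * f s) ≡ f t
∑⊆-δ []            f = ℤ.*-identityˡ _
∑⊆-δ (outside ∷ t) f = trans (cong₂ _+_ (∑⊆-δ t _) (∑⊆-zero {f = λ s → 0ℤ * f (inside ∷ s)} λ _ → refl)) (ℤ.+-identityʳ _)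
∑⊆-δ (inside ∷ t)  f = trans (cong₂ _+_ (∑⊆-zero {f = λ s → 0ℤ * f (outside ∷ s)} λ _ → refl) (∑⊆-δ t _)) (ℤ.+-identityˡ _)

-- Carries sums over simplices to the Boolean cube. Writing each term as a delta sum and exchanging
-- the sums weights `f s` by the number of preimages of `s`. Wherever `f` is nonzero that number is
-- one, by injectivity and the support condition.
sum-image : ∀ {m n} (v : Fin m → Subset n) → (∀ {i j} → v i ≡ v j → i ≡ j) →
            (f : Subset n → ℤ) → (∀ s → f s ≡ 0ℤ ⊎ ∃ λ i → v i ≡ s) →
            sumℤ (f ∘ v) ≡ ∑⊆ f
sum-image v inj f supp = begin
  sumℤ (λ i → f (v i))                                    ≡⟨ sum-cong-≗ (λ i → ∑⊆-δ (v i) f) ⟨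
  sumℤ (λ i → ∑⊆ (λ s → ⟦ does (v i ≟ˢ s) ⟧ * f s))       ≡⟨ sum-∑⊆-comm (λ i s → ⟦ does (v i ≟ˢ s) ⟧ * f s) ⟩
  ∑⊆ (λ s → sumℤ (λ i → ⟦ does (v i ≟ˢ s) ⟧ * f s))       ≡⟨ ∑⊆-cong fibre ⟩
  ∑⊆ f                                                    ∎
  where
  open ≡-Reasoning
  fibre : ∀ s → sumℤ (λ i → ⟦ does (v i ≟ˢ s) ⟧ * f s) ≡ f s
  fibre s with supp s
  ... | inj₁ fs≡0 = trans (ℤMat.sum-zero λ i → trans (cong (⟦ does (v i ≟ˢ s) ⟧ *_) fs≡0) (ℤ.*-zeroʳ ⟦ does (v i ≟ˢ s) ⟧)) (sym fs≡0)
  -- Injectivity replaces the delta on subsets by the delta on indices at the preimage `j`.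
  ... | inj₂ (j , refl) = trans (sum-cong-≗ λ i → cong (λ b → ⟦ b ⟧ * f (v j)) (does-⇔ (mk⇔ (sym ∘ inj) (cong v ∘ sym)) (v i ≟ˢ v j) (j ≟ i)))
                                (sum-𝟙 j (λ _ → f (v j)))

-- Alternating sums over intervals of the Boolean cube

infix 8 _≼_

_≼_ : ∀ {n} → Subset n → Subset n → ℤ
a ≼ b = ⟦ does (a ⊆? b) ⟧

-- The exponent is the cardinality, not the dimension: adjoining a vertex then multiplies by `-1ℤ`
-- definitionally, and the empty set receives the sign 1. On simplices this is `ω` negated.
sgn : ∀ {n} → Subset n → ℤ
sgn s = -1ℤ ^ ∣ s ∣

pull-1ℤ : ∀ p q r → p * (q * (-1ℤ * r)) ≡ -1ℤ * (p * (q * r))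
pull-1ℤ = solve-∀

-- Induction on the vertices. A vertex in `b` but not in `a` makes the sum cancel, one in `a` but
-- not in `b` makes the interval empty, and one on which they agree leaves a single surviving half.
∑-interval-sgn : ∀ {n} (a b : Subset n) →
                 ∑⊆ (λ s → a ≼ s * (s ≼ b * sgn s)) ≡ ⟦ does (a ≟ˢ b) ⟧ * sgn a
∑-interval-sgn [] [] = refl
∑-interval-sgn (outside ∷ a) (outside ∷ b) =
  trans (cong₂ _+_ (∑-interval-sgn a b) (∑⊆-zero λ s → ℤ.*-zeroʳ (a ≼ s))) (ℤ.+-identityʳ _)
-- The first vertex is free here; toggling it preserves the interval and flips the sign, so the
-- halves are `X` and its negative.
∑-interval-sgn (outside ∷ a) (inside ∷ b) = begin
  X + ∑⊆ (λ s → a ≼ s * (s ≼ b * (-1ℤ * sgn s)))  ≡⟨ cong (X +_) (∑⊆-cong λ s → pull-1ℤ (a ≼ s) (s ≼ b) (sgn s)) ⟩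
  X + ∑⊆ (λ s → -1ℤ * (a ≼ s * (s ≼ b * sgn s)))  ≡⟨ cong (X +_) (∑⊆-*ˡ -1ℤ (λ s → a ≼ s * (s ≼ b * sgn s))) ⟩
  X + -1ℤ * X                                     ≡⟨ cancel X ⟩
  0ℤ                                              ∎
  where
  open ≡-Reasoning
  X = ∑⊆ (λ s → a ≼ s * (s ≼ b * sgn s))
  cancel : ∀ x → x + -1ℤ * x ≡ 0ℤ
  cancel = solve-∀
∑-interval-sgn (inside ∷ a) (outside ∷ b) =
  cong₂ _+_ (∑⊆-zero {f = λ s → 0ℤ * (s ≼ b * sgn s)} λ _ → refl) (∑⊆-zero λ s → ℤ.*-zeroʳ (a ≼ s))
∑-interval-sgn (inside ∷ a) (inside ∷ b) = begin
  ∑⊆ (λ s → 0ℤ * (s ≼ b * sgn s)) + ∑⊆ (λ s → a ≼ s * (s ≼ b * (-1ℤ * sgn s)))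
    ≡⟨ cong₂ _+_ (∑⊆-zero {f = λ s → 0ℤ * (s ≼ b * sgn s)} λ _ → refl) (∑⊆-cong λ s → pull-1ℤ (a ≼ s) (s ≼ b) (sgn s)) ⟩
  0ℤ + ∑⊆ (λ s → -1ℤ * (a ≼ s * (s ≼ b * sgn s)))  ≡⟨ ℤ.+-identityˡ _ ⟩
  ∑⊆ (λ s → -1ℤ * (a ≼ s * (s ≼ b * sgn s)))       ≡⟨ ∑⊆-*ˡ -1ℤ (λ s → a ≼ s * (s ≼ b * sgn s)) ⟩
  -1ℤ * ∑⊆ (λ s → a ≼ s * (s ≼ b * sgn s))         ≡⟨ cong (-1ℤ *_) (∑-interval-sgn a b) ⟩
  -1ℤ * (⟦ does (a ≟ˢ b) ⟧ * sgn a)                ≡⟨ push ⟦ does (a ≟ˢ b) ⟧ (sgn a) ⟩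
  ⟦ does (a ≟ˢ b) ⟧ * (-1ℤ * sgn a)                ∎
  where
  open ≡-Reasoning
  push : ∀ p q → -1ℤ * (p * q) ≡ p * (-1ℤ * q)
  push = solve-∀

-- The extension of ω by 0 to the empty set.
ω̃ : ∀ {n} → Subset n → ℤ
ω̃ s = ⟦ does (⊥ ≟ˢ s) ⟧ - sgn s

sgn-⊥ : ∀ n → sgn (⊥ {n}) ≡ 1ℤ
sgn-⊥ n = cong (-1ℤ ^_) (∣⊥∣≡0 n)

ω̃-⊥ : ∀ n → ω̃ (⊥ {n}) ≡ 0ℤ
ω̃-⊥ n = cong₂ (λ b z → ⟦ b ⟧ - z) (dec-true (⊥ {n} ≟ˢ ⊥) refl) (sgn-⊥ n)

nonempty⇒≢⊥ : ∀ {n} {s : Subset n} → Nonempty s → ¬ ⊥ ≡ s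
nonempty⇒≢⊥ (_ , i∈s) refl = ∉⊥ i∈s

-sgn-nonempty : ∀ {n} {s : Subset n} → Nonempty s → - sgn s ≡ -1ℤ ^ (∣ s ∣ ∸ 1)
-- The subtraction is not truncated here: it removes exactly the factor contributed by this vertex.
-sgn-nonempty {s = inside ∷ s}  _                   = neg-neg (sgn s)
  where
  neg-neg : ∀ x → - (-1ℤ * x) ≡ x
  neg-neg = solve-∀
-sgn-nonempty {s = outside ∷ s} (suc i , there i∈s) = -sgn-nonempty (i , i∈s)

ω̃-nonempty : ∀ {n} {s : Subset n} → Nonempty s → ω̃ s ≡ -1ℤ ^ (∣ s ∣ ∸ 1)
ω̃-nonempty {s = s} ne = trans (cong (λ b → ⟦ b ⟧ - sgn s) (dec-false (⊥ ≟ˢ s) (nonempty⇒≢⊥ ne)))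
                              (trans (ℤ.+-identityˡ _) (-sgn-nonempty ne))

-- The delta part of `ω̃` picks out `s = ⊥`, which lies in the interval exactly when `a` is empty;
-- this gives the term `a ≼ ⊥`. The rest is the previous alternating sum, negated.
∑-interval-ω̃ : ∀ {n} (a b : Subset n) →
               ∑⊆ (λ s → a ≼ s * (s ≼ b * ω̃ s)) ≡ a ≼ ⊥ - ⟦ does (a ≟ˢ b) ⟧ * sgn a
∑-interval-ω̃ a b = begin
  ∑⊆ (λ s → a ≼ s * (s ≼ b * ω̃ s))
    ≡⟨ ∑⊆-cong (λ s → split (a ≼ s) (s ≼ b) ⟦ does (⊥ ≟ˢ s) ⟧ (sgn s)) ⟩
  ∑⊆ (λ s → ⟦ does (⊥ ≟ˢ s) ⟧ * (a ≼ s * s ≼ b) + -1ℤ * (a ≼ s * (s ≼ b * sgn s)))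
    ≡⟨ ∑⊆-+ (λ s → ⟦ does (⊥ ≟ˢ s) ⟧ * (a ≼ s * s ≼ b)) _ ⟩
  ∑⊆ (λ s → ⟦ does (⊥ ≟ˢ s) ⟧ * (a ≼ s * s ≼ b)) + ∑⊆ (λ s → -1ℤ * (a ≼ s * (s ≼ b * sgn s)))
    ≡⟨ cong₂ _+_ (∑⊆-δ ⊥ (λ s → a ≼ s * s ≼ b)) (trans (∑⊆-*ˡ -1ℤ (λ s → a ≼ s * (s ≼ b * sgn s))) (cong (-1ℤ *_) (∑-interval-sgn a b))) ⟩
  a ≼ ⊥ * ⊥ ≼ b + -1ℤ * (⟦ does (a ≟ˢ b) ⟧ * sgn a)
    ≡⟨ cong (λ t → a ≼ ⊥ * ⟦ t ⟧ + -1ℤ * (⟦ does (a ≟ˢ b) ⟧ * sgn a)) (dec-true (⊥ ⊆? b) ⊥⊆) ⟩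
  a ≼ ⊥ * 1ℤ + -1ℤ * (⟦ does (a ≟ˢ b) ⟧ * sgn a)
    ≡⟨ tidy (a ≼ ⊥) (⟦ does (a ≟ˢ b) ⟧ * sgn a) ⟩
  a ≼ ⊥ - ⟦ does (a ≟ˢ b) ⟧ * sgn a ∎
  where
  open ≡-Reasoning
  split : ∀ p q d z → p * (q * (d - z)) ≡ d * (p * q) + -1ℤ * (p * (q * z))
  split = solve-∀
  tidy : ∀ p q → p * 1ℤ + -1ℤ * q ≡ p - q
  tidy = solve-∀

≼-∩ : ∀ {n} (s a b : Subset n) → s ≼ (a ∩ b) ≡ s ≼ a * s ≼ b
≼-∩ s a b = trans (cong ⟦_⟧ (does-⇔ (mk⇔ (λ s⊆ → (λ {x} x∈s → p∩q⊆p a b (s⊆ x∈s)) , λ {x} x∈s → p∩q⊆q a b (s⊆ x∈s))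
                                        (λ (s⊆a , s⊆b) {x} x∈s → x∈p∩q⁺ (s⊆a x∈s , s⊆b x∈s)))
                                   (s ⊆? a ∩ b) (s ⊆? a ×-dec s ⊆? b)))
                  (⟦⟧-∧ (does (s ⊆? a)) (does (s ⊆? b)))

-1^k-involutive : ∀ k → -1ℤ ^ k * -1ℤ ^ k ≡ 1ℤ
-1^k-involutive zero    = refl
-1^k-involutive (suc k) = trans (square (-1ℤ ^ k)) (-1^k-involutive k)
  where
  square : ∀ x → -1ℤ * x * (-1ℤ * x) ≡ x * x
  square = solve-∀

-- Factorisation and inversion of the connection matrix over ℤ.

module Connection {n : ℕ} (G : SimplicialComplex n) where

  open SimplicialComplex G
  open ≡-Reasoning

  infix 8 _⊑_

  _⊑_ : Simplex → Simplex → ℤ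
  x ⊑ y = vertices x ≼ vertices y

  -- As `b` lies in a simplex, closure makes every nonempty subset of `b` a simplex, so the sum runs
  -- over a full Boolean interval up to the empty set. Here `b` may itself be empty, as happens for
  -- the intersection of disjoint simplices.
  sum-interval : ∀ (a b : Subset n) y → b ⊆ vertices y →
                 sumℤ (λ z → a ≼ vertices z * (vertices z ≼ b * ω z)) ≡ a ≼ ⊥ - ⟦ does (a ≟ˢ b) ⟧ * sgn a
  sum-interval a b y b⊆y = begin
    sumℤ (λ z → a ≼ vertices z * (vertices z ≼ b * ω z))
      ≡⟨ sum-cong-≗ (λ z → cong (λ w → a ≼ vertices z * (vertices z ≼ b * w)) (ω̃-nonempty (nonempty z))) ⟨
    sumℤ (f ∘ vertices)
      ≡⟨ sum-image vertices injective f support ⟩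
    ∑⊆ f
      ≡⟨ ∑-interval-ω̃ a b ⟩
    a ≼ ⊥ - ⟦ does (a ≟ˢ b) ⟧ * sgn a ∎
    where
    f : Subset n → ℤ
    f s = a ≼ s * (s ≼ b * ω̃ s)

    support : ∀ s → f s ≡ 0ℤ ⊎ ∃ λ z → vertices z ≡ s
    support s with nonempty? s
    -- The empty set is not a simplex, but `ω̃` vanishes on it.
    ... | no empty rewrite Empty-unique empty | ω̃-⊥ n = inj₁ (annihilate (a ≼ ⊥) (⊥ ≼ b))
      where
      annihilate : ∀ p q → p * (q * 0ℤ) ≡ 0ℤ
      annihilate = solve-∀
    ... | yes ne with s ⊆? b
    ...   | no s⊈b  = inj₁ (ℤ.*-zeroʳ (a ≼ s))
    ...   | yes s⊆b = inj₂ (closed y s ne λ x∈s → b⊆y (s⊆b x∈s))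

  -- This is `N D N = D`. The term at the empty set drops out because `x` is nonempty, and
  -- `injective` turns equal vertex sets into equal indices.
  sum-faces : ∀ x y → sumℤ (λ z → x ⊑ z * (z ⊑ y * ω z)) ≡ 𝟙 x y * ω x
  sum-faces x y = begin
    sumℤ (λ z → x ⊑ z * (z ⊑ y * ω z))
      ≡⟨ sum-interval (vertices x) (vertices y) y (λ x∈y → x∈y) ⟩
    vertices x ≼ ⊥ - ⟦ does (vertices x ≟ˢ vertices y) ⟧ * sgn (vertices x)
      ≡⟨ cong₂ (λ b c → ⟦ b ⟧ - ⟦ c ⟧ * sgn (vertices x))
           (dec-false (vertices x ⊆? ⊥) (λ x⊆⊥ → let (_ , i∈x) = nonempty x in ∉⊥ (x⊆⊥ i∈x)))
           (does-⇔ (mk⇔ injective (cong vertices)) (vertices x ≟ˢ vertices y) (x ≟ y)) ⟩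
    0ℤ - 𝟙 x y * sgn (vertices x)
      ≡⟨ move (𝟙 x y) (sgn (vertices x)) ⟩
    𝟙 x y * - sgn (vertices x)
      ≡⟨ cong (𝟙 x y *_) (-sgn-nonempty (nonempty x)) ⟩
    𝟙 x y * ω x ∎
    where
    move : ∀ p q → 0ℤ - p * q ≡ p * - q
    move = solve-∀

  ω²≡1 : ∀ x → ω x * ω x ≡ 1ℤ
  ω²≡1 x = -1^k-involutive (∣ vertices x ∣ ∸ 1)

  -- Here `N x y` is `x ⊑ y`; multiplication by the diagonal matrix `D` is written out entrywise.
  Nᵀ DN DNᵀD : ℤMat.Mat size
  Nᵀ   x y = y ⊑ x
  DN   x y = ω x * x ⊑ y
  DNᵀD x y = ω x * y ⊑ x * ω y

  g : ℤMat.Mat size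
  g x y = ω x * ω y * χ (W⁺ x ∩ W⁺ y)

  -- The common faces of `x` and `y` are the nonempty subsets of their intersection. Their Euler
  -- characteristic is 1, or 0 if the intersection is empty.
  L≋Nᵀ·DN : L ℤMat.≋ Nᵀ · DN
  L≋Nᵀ·DN x y = sym (begin
    sumℤ (λ z → z ⊑ x * (ω z * z ⊑ y))
      -- The factor `⊥ ≼ vertices z` is always 1; it is inserted to present the faces as an interval
      -- starting at `⊥`.
      ≡⟨ sum-cong-≗ summand ⟩
    sumℤ (λ z → ⊥ ≼ vertices z * (vertices z ≼ x∩y * ω z))
      ≡⟨ sum-interval ⊥ x∩y x (p∩q⊆p (vertices x) (vertices y)) ⟩
    ⊥ {n} ≼ ⊥ - ⟦ does (⊥ ≟ˢ x∩y) ⟧ * sgn (⊥ {n})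
      ≡⟨ cong₂ (λ b z → ⟦ b ⟧ - ⟦ does (⊥ ≟ˢ x∩y) ⟧ * z) (dec-true (⊥ {n} ⊆? ⊥) ⊥⊆) (sgn-⊥ n) ⟩
    1ℤ - ⟦ does (⊥ ≟ˢ x∩y) ⟧ * 1ℤ
      ≡⟨ complement ⟩
    L x y ∎)
    where
    x∩y : Subset n
    x∩y = vertices x ∩ vertices y

    rearrange : ∀ p w q → p * (w * q) ≡ 1ℤ * (p * q * w)
    rearrange = solve-∀

    summand : ∀ z → z ⊑ x * (ω z * z ⊑ y) ≡ ⊥ ≼ vertices z * (vertices z ≼ x∩y * ω z)
    summand z = trans (rearrange (z ⊑ x) (ω z) (z ⊑ y))
      (sym (cong₂ (λ b p → ⟦ b ⟧ * (p * ω z)) (dec-true (⊥ ⊆? vertices z) ⊥⊆) (≼-∩ (vertices z) (vertices x) (vertices y))))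

    complement : 1ℤ - ⟦ does (⊥ ≟ˢ x∩y) ⟧ * 1ℤ ≡ L x y
    complement with nonempty? x∩y
    ... | yes ne   = cong (λ b → 1ℤ - ⟦ b ⟧ * 1ℤ) (dec-false (⊥ ≟ˢ x∩y) (nonempty⇒≢⊥ ne))
    ... | no empty = cong (λ b → 1ℤ - ⟦ b ⟧ * 1ℤ) (dec-true (⊥ ≟ˢ x∩y) (sym (Empty-unique empty)))

  -- Membership of `z` in both stars is the product of two inclusion indicators, so `χ` of the
  -- intersection is an entry of `N D Nᵀ`; the outer signs supply the two remaining factors `D`.
  g≋DN·DNᵀD : g ℤMat.≋ DN · DNᵀD
  g≋DN·DNᵀD x y = begin
    ω x * ω y * χ (W⁺ x ∩ W⁺ y)
      ≡⟨ *-distribˡ-sum (ω x * ω y) (λ z → if lookup (W⁺ x ∩ W⁺ y) z then ω z else 0ℤ) ⟩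
    sumℤ (λ z → ω x * ω y * (if lookup (W⁺ x ∩ W⁺ y) z then ω z else 0ℤ))
      ≡⟨ sum-cong-≗ summand ⟩
    sumℤ (λ z → ω x * x ⊑ z * (ω z * y ⊑ z * ω y)) ∎
    where
    if-* : ∀ b w → (if b then w else 0ℤ) ≡ ⟦ b ⟧ * w
    if-* true  w = sym (ℤ.*-identityˡ w)
    if-* false w = refl

    lookup-∩ : ∀ z → lookup (W⁺ x ∩ W⁺ y) z ≡ does (vertices x ⊆? vertices z) ∧ does (vertices y ⊆? vertices z)
    lookup-∩ z = trans (lookup-zipWith _∧_ z (W⁺ x) (W⁺ y))
      (cong₂ _∧_ (lookup∘tabulate (λ y → does (vertices x ⊆? vertices y)) z)
                 (lookup∘tabulate (λ x → does (vertices y ⊆? vertices x)) z))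

    rearrange : ∀ u v p q w → u * v * (p * q * w) ≡ u * p * (w * q * v)
    rearrange = solve-∀

    summand : ∀ z → ω x * ω y * (if lookup (W⁺ x ∩ W⁺ y) z then ω z else 0ℤ) ≡ ω x * x ⊑ z * (ω z * y ⊑ z * ω y)
    summand z = begin
      ω x * ω y * (if lookup (W⁺ x ∩ W⁺ y) z then ω z else 0ℤ)
        ≡⟨ cong (ω x * ω y *_) (trans (if-* (lookup (W⁺ x ∩ W⁺ y) z) (ω z)) (cong (_* ω z) (trans (cong ⟦_⟧ (lookup-∩ z)) (⟦⟧-∧ (does (vertices x ⊆? vertices z)) (does (vertices y ⊆? vertices z)))))) ⟩
      ω x * ω y * (x ⊑ z * y ⊑ z * ω z)
        ≡⟨ rearrange (ω x) (ω y) (x ⊑ z) (y ⊑ z) (ω z) ⟩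
      ω x * x ⊑ z * (ω z * y ⊑ z * ω y) ∎

  -- Multiplying `N D N = D` by `D` on the left leaves `D D`, and the signs square to 1.
  DN·DN≋𝟙 : DN · DN ℤMat.≋ 𝟙
  DN·DN≋𝟙 x y = begin
    sumℤ (λ z → ω x * x ⊑ z * (ω z * z ⊑ y))    ≡⟨ sum-cong-≗ (λ z → rearrange (ω x) (x ⊑ z) (ω z) (z ⊑ y)) ⟩
    sumℤ (λ z → ω x * (x ⊑ z * (z ⊑ y * ω z)))  ≡⟨ *-distribˡ-sum (ω x) (λ z → x ⊑ z * (z ⊑ y * ω z)) ⟨
    ω x * sumℤ (λ z → x ⊑ z * (z ⊑ y * ω z))    ≡⟨ cong (ω x *_) (sum-faces x y) ⟩
    ω x * (𝟙 x y * ω x)                         ≡⟨ swap (ω x) (𝟙 x y) ⟩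
    𝟙 x y * (ω x * ω x)                         ≡⟨ cong (𝟙 x y *_) (ω²≡1 x) ⟩
    𝟙 x y * 1ℤ                                  ≡⟨ ℤ.*-identityʳ (𝟙 x y) ⟩
    𝟙 x y                                       ∎
    where
    rearrange : ∀ u p w q → u * p * (w * q) ≡ u * (p * (q * w))
    rearrange = solve-∀
    swap : ∀ u d → u * (d * u) ≡ d * (u * u)
    swap = solve-∀

  -- The transpose of `DN·DN≋𝟙`, regrouped.
  Nᵀ·DNᵀD≋𝟙 : Nᵀ · DNᵀD ℤMat.≋ 𝟙
  Nᵀ·DNᵀD≋𝟙 x y = begin
    sumℤ (λ z → z ⊑ x * (ω z * y ⊑ z * ω y))    ≡⟨ sum-cong-≗ (λ z → rearrange (z ⊑ x) (ω z) (y ⊑ z) (ω y)) ⟩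
    sumℤ (λ z → ω y * y ⊑ z * (ω z * z ⊑ x))    ≡⟨ DN·DN≋𝟙 y x ⟩
    𝟙 y x                                       ≡⟨ ℤMat.𝟙-sym y x ⟩
    𝟙 x y                                       ∎
    where
    rearrange : ∀ q w p u → q * (w * p * u) ≡ u * p * (w * q)
    rearrange = solve-∀

  L·g≋𝟙 : L · g ℤMat.≋ 𝟙
  L·g≋𝟙 x y = trans (ℤMat.·-cong L≋Nᵀ·DN g≋DN·DNᵀD x y) (ℤMat.telescope Nᵀ DN DN DNᵀD DN·DN≋𝟙 Nᵀ·DNᵀD≋𝟙 x y)

  g·L≋𝟙 : g · L ℤMat.≋ 𝟙
  g·L≋𝟙 = ℤMat.symmetric-commute L g L-sym g-sym L·g≋𝟙
    where
    L-sym : ∀ x y → L x y ≡ L y x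
    L-sym x y = cong (λ s → ⟦ does (nonempty? s) ⟧) (∩-comm (vertices x) (vertices y))
    g-sym : ∀ x y → g x y ≡ g y x
    g-sym x y = cong₂ (λ w A → w * χ A) (ℤ.*-comm (ω x) (ω y)) (∩-comm (W⁺ x) (W⁺ y))

-- Transfer from ℤ to ℚ.

fromℚᵘ-homo-+ : ∀ p q → ℚ.fromℚᵘ (p ℚᵘ.+ q) ≡ ℚ.fromℚᵘ p ℚ.+ ℚ.fromℚᵘ q
fromℚᵘ-homo-+ p q = ℚ.toℚᵘ-injective (ℚᵘ.≃-trans (ℚ.toℚᵘ-fromℚᵘ (p ℚᵘ.+ q))
  (ℚᵘ.≃-sym (ℚᵘ.≃-trans (ℚ.toℚᵘ-homo-+ (ℚ.fromℚᵘ p) (ℚ.fromℚᵘ q)) (ℚᵘ.+-cong (ℚ.toℚᵘ-fromℚᵘ p) (ℚ.toℚᵘ-fromℚᵘ q)))))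

fromℚᵘ-homo-* : ∀ p q → ℚ.fromℚᵘ (p ℚᵘ.* q) ≡ ℚ.fromℚᵘ p ℚ.* ℚ.fromℚᵘ q
fromℚᵘ-homo-* p q = ℚ.toℚᵘ-injective (ℚᵘ.≃-trans (ℚ.toℚᵘ-fromℚᵘ (p ℚᵘ.* q))
  (ℚᵘ.≃-sym (ℚᵘ.≃-trans (ℚ.toℚᵘ-homo-* (ℚ.fromℚᵘ p) (ℚ.fromℚᵘ q)) (ℚᵘ.*-cong (ℚ.toℚᵘ-fromℚᵘ p) (ℚ.toℚᵘ-fromℚᵘ q)))))

fromℤ-homo-+ : ∀ a b → fromℤ (a + b) ≡ fromℤ a ℚ.+ fromℤ b
-- Unnormalised addition over denominator 1 produces the numerator `a * 1ℤ + b * 1ℤ`, so these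
-- factors are cleared first.
fromℤ-homo-+ a b = trans (sym (cong fromℤ (cong₂ _+_ (ℤ.*-identityʳ a) (ℤ.*-identityʳ b))))
                         (fromℚᵘ-homo-+ (ℚᵘ.mkℚᵘ a 0) (ℚᵘ.mkℚᵘ b 0))

fromℤ-homo-* : ∀ a b → fromℤ (a * b) ≡ fromℤ a ℚ.* fromℤ b
fromℤ-homo-* a b = fromℚᵘ-homo-* (ℚᵘ.mkℚᵘ a 0) (ℚᵘ.mkℚᵘ b 0)

fromℤ-sum : ∀ {m} (f : Fin m → ℤ) → fromℤ (sumℤ f) ≡ sumℚ (fromℤ ∘ f)
fromℤ-sum {zero}  f = refl
fromℤ-sum {suc m} f = trans (fromℤ-homo-+ (f zero) _) (cong (fromℤ (f zero) ℚ.+_) (fromℤ-sum (f ∘ suc)))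

fromℤ-inverse : ∀ {m} (A B : ℤMat.Mat m) → A · B ℤMat.≋ 𝟙 →
                ∀ i j → ((λ i j → fromℤ (A i j)) ⊗ (λ i j → fromℤ (B i j))) i j ≡ identity i j
fromℤ-inverse A B AB i k = begin
  sumℚ (λ j → fromℤ (A i j) ℚ.* fromℤ (B j k))  ≡⟨ sumℚ-cong (λ j → fromℤ-homo-* (A i j) (B j k)) ⟨
  sumℚ (λ j → fromℤ (A i j * B j k))            ≡⟨ fromℤ-sum (λ j → A i j * B j k) ⟨
  fromℤ ((A · B) i k)                           ≡⟨ cong fromℤ (AB i k) ⟩
  fromℤ (𝟙 i k)                                 ≡⟨ fromℤ-⟦⟧ (does (i ≟ k)) ⟩
  identity i k                                  ∎
  where
  open ≡-Reasoning
  open SemiringSum (CommutativeRing.semiring ℚ.+-*-commutativeRing) using () renaming (sum-cong-≗ to sumℚ-cong)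
  fromℤ-⟦⟧ : ∀ b → fromℤ ⟦ b ⟧ ≡ (if b then ℚ.1ℚ else ℚ.0ℚ)
  fromℤ-⟦⟧ true  = refl
  fromℤ-⟦⟧ false = refl

theorem4 : ∀ {n : ℕ} (G : SimplicialComplex n) → let open SimplicialComplex G in
    (∃ λ g → IsInverse (connectionMatrix G) g)
    × (∀ g → IsInverse (connectionMatrix G) g →
    ∀ (x y : Simplex) → g x y ≡ fromℤ (ω x * ω y * χ (W⁺ x ∩ W⁺ y)))
-- The inverse has integer entries, so both products are computed over ℤ and then transported.
theorem4 G = (gℚ , L⊗g , fromℤ-inverse g L g·L≋𝟙)
           -- Uniqueness: `h` as a left inverse meets `gℚ` as a right inverse.
           , λ h (_ , h⊗L) → ℚMat.left-inverse≋right-inverse (connectionMatrix G) h gℚ h⊗L L⊗g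
  where
  open SimplicialComplex G using (size; L)
  open Connection G using (g; L·g≋𝟙; g·L≋𝟙)

  gℚ : Matrix size
  gℚ x y = fromℤ (g x y)

  L⊗g : ∀ x y → (connectionMatrix G ⊗ gℚ) x y ≡ identity x y
  L⊗g = fromℤ-inverse L g L·g≋𝟙
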